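{- For each integer $n\ge 0$, let $a_n$ denote the number of tilings of a $7\times 8n$ board by $L$-tetrominoes (rotations allowed, reflections not allowed). Then the generating function is $\sum_{n\ge 0}a_nt^n=-A(t)/B(t)$, where \begin{align*} A(t) &= 54 t^{25}-2805 t^{24}+61114 t^{23}-437586 t^{22}+756220 t^{21}-1683407 t^{20}+201818 t^{19}\\ &\qquad -4732871 t^{18}+5812686 t^{17}+6513779 t^{16}-5791118 t^{15}-15036852 t^{14}\\ &\qquad-14634004 t^{13} -854802 t^{12}+887014 t^{11}-5043234 t^{10}-3069842 t^{9}+558740 t^{8}\\ &\qquad +642802 t^{7}+30014 t^{6}-18954 t^{5}-2525 t^{4}-486 t^{3}-168 t^{2}-16 t +1 , \end{align*} and \begin{align*} B(t) &= 3 t^{26}-572 t^{25}+20037 t^{24}-299100 t^{23}+1278161 t^{22}-3054798 t^{21}+5765025 t^{20}\\ &\qquad -3431380 t^{19} +23400340 t^{18}-15270754 t^{17}-4408598 t^{16}-17388698 t^{15}\\ &\qquad +20834748 t^{14}+39814896 t^{13}+28440798 t^{12}+16183108 t^{11}+10581385 t^{10}\\ &\qquad +6300318 t^{9}-880287 t^{8}-1336202 t^{7}-197778 t^{6}-1116 t^{5}-48 t^{4}\\ &\qquad +356 t^{3}+259 t^{2}+30 t -1 . \end{align*} The first terms of the sequence $(a_n)_{n\ge 0}$ are $1, 14, 511, 18826, 699540, 26023308, 968374240, 36035363996, \ldots$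
   Context: A $k\times n$ board is the rectangle of unit cells $\{(x,y)\in\mathbb{Z}^2: 0\le x<n,\ 0\le y<k\}$, where each cell is named by its bottom left corner. The $L$-tetromino tiles are the translates of the four sets (the rotations of the $L$-tetromino) \[\{(0,0),(0,1),(0,2),(1,0)\},\ \{(0,0),(0,1),(1,1),(2,1)\},\ \{(0,0),(1,0),(2,0),(2,1)\},\ \{(0,2),(1,0),(1,1),(1,2)\}.\] Reflections of these shapes are not allowed. A tiling of a board is a partition of its set of cells into such tiles (each tile may be used any number of times); two tilings are the same only if they are equal as partitions of the board (no identification under symmetries). The empty board ($n=0$) has exactly one tiling. Generating functions are formal power series in $t$ with rational coefficients. -}

module Defs where

open import Data.Fin.Base using (Fin; zero; suc; toℕ)
open import Data.Integer.Base as ℤ using (ℤ; +_; 0ℤ)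
open import Data.List.Base using (List; []; _∷_; map; _++_; filter; length;
  reverse; upTo; cartesianProduct; cartesianProductWith)
import Data.List.Membership.DecPropositional as DecMembership
open import Data.List.Relation.Binary.Disjoint.Propositional using (Disjoint)
import Data.List.Relation.Binary.Disjoint.DecPropositional as DecDisjoint
open import Data.List.Relation.Unary.All using (All; all?)
open import Data.List.Relation.Unary.AllPairs using (AllPairs; allPairs?)
open import Data.List.Relation.Unary.Any using (Any; any?)
open import Data.Nat.Base as ℕ using (ℕ; zero; suc; _∸_)
import Data.Nat.Properties as ℕₚ
open import Data.Product.Base using (_×_; _,_)
open import Data.Product.Properties using (≡-dec)
open import Data.Rational.Base as ℚ using (ℚ; 0ℚ; 1ℚ)
open import Data.Rational.Literals using (fromℤ)
import Data.Rational.Properties as ℚₚ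
open import Data.Vec.Base as Vec using (Vec; []; _∷_)
open import Relation.Binary.Definitions using (DecidableEquality)
open import Relation.Binary.PropositionalEquality
  using (_≡_; refl; sym; cong; cong₂; module ≡-Reasoning)
open import Relation.Nullary.Decidable using (_×-dec_)
open import Relation.Unary using (Decidable)

open import Algebra.Properties.Monoid.Sum ℚₚ.+-0-monoid using (sum; sum-cong-≗)

------------------------------------------------------------------------
-- Tilings

Cell : Set
Cell = ℕ × ℕ

_≟_ : DecidableEquality Cell
_≟_ = ≡-dec ℕₚ._≟_ ℕₚ._≟_

open DecMembership _≟_ using (_∈_; _∈?_)
open DecDisjoint _≟_ using (disjoint?)

-- The cells (x , y) with x < n and y < k.
board : (k n : ℕ) → List Cell
board k n = cartesianProduct (upTo n) (upTo k)

L-tetrominoes : List (List Cell)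
L-tetrominoes =
    ((0 , 0) ∷ (0 , 1) ∷ (0 , 2) ∷ (1 , 0) ∷ [])
  ∷ ((0 , 0) ∷ (0 , 1) ∷ (1 , 1) ∷ (2 , 1) ∷ [])
  ∷ ((0 , 0) ∷ (1 , 0) ∷ (2 , 0) ∷ (2 , 1) ∷ [])
  ∷ ((0 , 2) ∷ (1 , 0) ∷ (1 , 1) ∷ (1 , 2) ∷ [])
  ∷ []

translate : Cell → List Cell → List Cell
translate (u , v) = map λ (x , y) → (u ℕ.+ x , v ℕ.+ y)

-- All tiles contained in the k × n board, each listed once.  Every
-- L-tetromino above touches both coordinate axes, so a translate inside
-- the board has its translation vector in the board as well.
tiles : (k n : ℕ) → List (List Cell)
tiles k n =
  filter (all? (_∈? board k n))
         (cartesianProductWith translate (board k n) L-tetrominoes)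

-- A set of tiles contained in the board is a tiling if it partitions
-- the cells of the board.
IsTiling : (k n : ℕ) → List (List Cell) → Set
IsTiling k n T =
  AllPairs Disjoint T × All (λ c → Any (c ∈_) T) (board k n)

isTiling? : ∀ k n → Decidable (IsTiling k n)
isTiling? k n T =
  allPairs? disjoint? T ×-dec all? (λ c → any? (c ∈?_) T) (board k n)

sublists : {X : Set} → List X → List (List X)
sublists []       = [] ∷ []
sublists (x ∷ xs) = map (x ∷_) (sublists xs) ++ sublists xs

-- Distinct entries of tiles k n are distinct as sets of cells, so its
-- sublists represent every set of tiles in the board exactly once.
numTilings : (k n : ℕ) → ℕ
numTilings k n = length (filter (isTiling? k n) (sublists (tiles k n)))

------------------------------------------------------------------------
-- Formal power series over ℚ

Series : Set
Series = ℕ → ℚ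

infix  4 _≈_
infixl 7 _*_ _/_
infix  8 -_

_≈_ : Series → Series → Set
F ≈ G = ∀ n → F n ≡ G n

-_ : Series → Series
(- F) n = ℚ.- F n

_*_ : Series → Series → Series
(F * G) n = sum {suc n} λ i → F (toℕ i) ℚ.* G (n ∸ toℕ i)

-- Long division: quotient F G n holds the first n coefficients of
-- F / G, in order of decreasing degree.
quotient : (F G : Series) .{{_ : ℚ.NonZero (G 0)}} (n : ℕ) → Vec ℚ n
quotient F G zero    = []
quotient F G (suc n) = (F n ℚ.- sum tail) ℚ.÷ G 0 ∷ cs
  where
  cs : Vec ℚ n
  cs = quotient F G n
  tail : Fin n → ℚ
  tail i = G (suc (toℕ i)) ℚ.* Vec.lookup cs i

_/_ : (F G : Series) .{{_ : ℚ.NonZero (G 0)}} → Series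
(F / G) n = Vec.head (quotient F G (suc n))

lookup-quotient : ∀ F G .{{_ : ℚ.NonZero (G 0)}} n (i : Fin n) →
                  Vec.lookup (quotient F G n) i ≡ (F / G) (n ∸ suc (toℕ i))
lookup-quotient F G (suc n) zero    = refl
lookup-quotient F G (suc n) (suc i) = lookup-quotient F G n i

*-/-cancel : ∀ F G .{{_ : ℚ.NonZero (G 0)}} → G * (F / G) ≈ F
*-/-cancel F G n = begin
  g ℚ.* ((F n ℚ.- s) ℚ.* ℚ.1/ g) ℚ.+ sum t
    ≡⟨ cong₂ ℚ._+_ cancel (sum-cong-≗ λ i → cong (G (suc (toℕ i)) ℚ.*_)
                             (sym (lookup-quotient F G n i))) ⟩
  (F n ℚ.- s) ℚ.+ s
    ≡⟨ ℚₚ.+-assoc (F n) (ℚ.- s) s ⟩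
  F n ℚ.+ (ℚ.- s ℚ.+ s)
    ≡⟨ cong (F n ℚ.+_) (ℚₚ.+-inverseˡ s) ⟩
  F n ℚ.+ 0ℚ
    ≡⟨ ℚₚ.+-identityʳ (F n) ⟩
  F n ∎
  where
  open ≡-Reasoning
  g s : ℚ
  g = G 0
  s = sum λ i → G (suc (toℕ i)) ℚ.* Vec.lookup (quotient F G n) i
  t : Fin n → ℚ
  t i = G (suc (toℕ i)) ℚ.* (F / G) (n ∸ suc (toℕ i))
  cancel : g ℚ.* ((F n ℚ.- s) ℚ.* ℚ.1/ g) ≡ F n ℚ.- s
  cancel = begin
    g ℚ.* ((F n ℚ.- s) ℚ.* ℚ.1/ g)  ≡⟨ ℚₚ.*-comm g _ ⟩
    (F n ℚ.- s) ℚ.* ℚ.1/ g ℚ.* g    ≡⟨ ℚₚ.*-assoc (F n ℚ.- s) (ℚ.1/ g) g ⟩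
    (F n ℚ.- s) ℚ.* (ℚ.1/ g ℚ.* g)  ≡⟨ cong ((F n ℚ.- s) ℚ.*_) (ℚₚ.*-inverseˡ g) ⟩
    (F n ℚ.- s) ℚ.* 1ℚ              ≡⟨ ℚₚ.*-identityʳ (F n ℚ.- s) ⟩
    F n ℚ.- s                       ∎

generatingFunction : (ℕ → ℕ) → Series
generatingFunction a n = fromℤ (+ a n)

coefficient : List ℤ → ℕ → ℤ
coefficient []       _       = 0ℤ
coefficient (c ∷ _)  zero    = c
coefficient (_ ∷ cs) (suc n) = coefficient cs n

-- Coefficients are given from the leading one down to the constant one.
polynomial : List ℤ → Series
polynomial cs n = fromℤ (coefficient (reverse cs) n)

A : Series
A = polynomial
  ( + 54 ∷ ℤ.- + 2805 ∷ + 61114 ∷ ℤ.- + 437586 ∷ + 756220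
  ∷ ℤ.- + 1683407 ∷ + 201818 ∷ ℤ.- + 4732871 ∷ + 5812686 ∷ + 6513779
  ∷ ℤ.- + 5791118 ∷ ℤ.- + 15036852 ∷ ℤ.- + 14634004 ∷ ℤ.- + 854802 ∷ + 887014
  ∷ ℤ.- + 5043234 ∷ ℤ.- + 3069842 ∷ + 558740 ∷ + 642802 ∷ + 30014
  ∷ ℤ.- + 18954 ∷ ℤ.- + 2525 ∷ ℤ.- + 486 ∷ ℤ.- + 168 ∷ ℤ.- + 16
  ∷ + 1 ∷ [])

B : Series
B = polynomial
  ( + 3 ∷ ℤ.- + 572 ∷ + 20037 ∷ ℤ.- + 299100 ∷ + 1278161
  ∷ ℤ.- + 3054798 ∷ + 5765025 ∷ ℤ.- + 3431380 ∷ + 23400340 ∷ ℤ.- + 15270754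
  ∷ ℤ.- + 4408598 ∷ ℤ.- + 17388698 ∷ + 20834748 ∷ + 39814896 ∷ + 28440798
  ∷ + 16183108 ∷ + 10581385 ∷ + 6300318 ∷ ℤ.- + 880287 ∷ ℤ.- + 1336202
  ∷ ℤ.- + 197778 ∷ ℤ.- + 1116 ∷ ℤ.- + 48 ∷ + 356 ∷ + 259
  ∷ + 30 ∷ ℤ.- + 1 ∷ [])

instance
  B₀-nonZero : ℚ.NonZero (B 0)
  B₀-nonZero = _

a : ℕ → ℕ
a n = numTilings 7 (8 ℕ.* n)

{-# OPTIONS --safe #-}

-- Decide for each translate of a tile, in order of its translation vector,
-- whether to use it.  Once all tiles anchored in the leftmost column have been
-- decided, that column has to be covered, and only the next two columns can be
-- partially covered: the possible pairs of these form the frontiers, and the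
-- number of ways to complete a frontier satisfies a linear recursion in the
-- number of full columns behind it.  For height 7 only 658 frontiers can be
-- reached, in 8 classes according to the number of columns modulo 8.  Once the
-- relation given by the coefficients of B holds between the completions with
-- 8, 16, …, 216 full columns for all frontiers of one class, it continues to
-- hold with 8 m more columns, by linearity.  The rest is a finite computation.

module Submission where

open import Algebra.Properties.CommutativeSemigroup using (interchange)
import Algebra.Properties.Group
import Algebra.Properties.Monoid.Sum
open import Data.Bool.Base using (Bool; true; false; not; if_then_else_; T; _∧_)
open import Data.Bool.ListAction using (all)
import Data.Bool.Properties as Boolₚ
open import Data.Empty using (⊥; ⊥-elim)
open import Data.Fin.Base using (toℕ)
open import Data.Integer.Base as ℤ using (ℤ; +_; 0ℤ)
import Data.Integer.Properties as ℤₚ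
open import Data.List.Base as List using (List; []; _∷_; map; _++_; concatMap;
  foldl; filter; filterᵇ; length; take; reverse; upTo; applyUpTo;
  applyDownFrom; cartesianProduct; cartesianProductWith)
import Data.List.Membership.DecPropositional as DecMembership
open import Data.List.Membership.Propositional using (_∈_; _∉_)
open import Data.List.Membership.Propositional.Properties
  using (∈-map⁻; ∈-upTo⁺; ∈-upTo⁻; ∈-cartesianProduct⁺; ∈-cartesianProduct⁻)
import Data.List.Properties as Listₚ
open import Data.List.Relation.Binary.Disjoint.Propositional using (Disjoint)
open import Data.List.Relation.Binary.Pointwise as Pointwise using (Pointwise; []; _∷_)
open import Data.List.Relation.Unary.All as All using (All; []; _∷_)
import Data.List.Relation.Unary.All.Properties as Allₚ
open import Data.List.Relation.Unary.AllPairs using (AllPairs; []; _∷_)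
import Data.List.Relation.Unary.AllPairs.Properties as AllPairsₚ
open import Data.List.Relation.Unary.Any using (Any; here; there)
open import Data.Maybe.Base as Maybe using (Maybe; just; fromMaybe)
import Data.Maybe.Properties as Maybeₚ
open import Data.Maybe.Relation.Unary.All as MaybeAll using (just; nothing)
open import Data.Nat.Base as ℕ using (ℕ; zero; suc; _+_; _∸_; _<_; z≤n; s≤s; z<s; s<s)
open import Data.Nat.Induction using (<-rec)
open import Data.Nat.ListAction using (sum)
open import Data.Nat.ListAction.Properties using (sum-++)
import Data.Nat.Properties as ℕₚ
open import Data.Product.Base using (_×_; _,_; proj₁; proj₂; map₁; Σ-syntax)
open import Data.Rational.Base as ℚ using (ℚ; ↥_)
open import Data.Rational.Literals using (fromℤ)
import Data.Rational.Properties as ℚₚ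
import Data.Rational.Unnormalised.Base as ℚᵘ
import Data.Rational.Unnormalised.Properties as ℚᵘₚ
open import Data.Unit.Base using (⊤; tt)
open import Data.Vec.Base as Vec using (Vec; []; _∷_; replicate)
import Data.Vec.Properties as Vecₚ
open import Defs
open import Function.Base using (_∘_)
open import Function.Bundles using (_⇔_; mk⇔; Equivalence)
import Function.Construct.Composition as Composition
open import Level using (Level)
open import Relation.Binary.Definitions using (DecidableEquality)
open import Relation.Binary.PropositionalEquality
  using (_≡_; _≢_; _≗_; refl; sym; trans; cong; cong₂; subst; subst₂; module ≡-Reasoning)
open import Relation.Nullary.Decidable using (Dec; map′; does; yes; no; _×-dec_; toWitness)
open import Relation.Nullary.Negation using (¬_; contradiction)
open import Relation.Unary using (Pred; Decidable)

open Equivalence using (to; from)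
open DecMembership _≟_ using (_∈?_)
module ℚΣ = Algebra.Properties.Monoid.Sum ℚₚ.+-0-monoid
module ℚGroup = Algebra.Properties.Group ℚₚ.+-0-group

private variable
  X Y : Set
  p q : Level

-- Regions and the counting recursion

Tile : Set
Tile = List Cell

Column : Set
Column = List Bool

-- The set of cells yet to be covered, column by column.
Region : ℕ → Set
Region = Vec Column

private variable
  m n k : ℕ

-- Positions outside the column count as not free, so a tile that fits a region automatically lies
-- inside it.
isFree : Column → ℕ → Bool
isFree []      _       = false
isFree (b ∷ _) zero    = b
isFree (_ ∷ w) (suc y) = isFree w y

fill : Column → ℕ → Column
fill []      _       = []
fill (_ ∷ w) zero    = false ∷ w
fill (b ∷ w) (suc y) = b ∷ fill w y

free : Region n → Cell → Bool
free []      _           = false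
free (w ∷ _) (zero  , y) = isFree w y
free (_ ∷ R) (suc x , y) = free R (x , y)

erase : Region n → Cell → Region n
erase []      _           = []
erase (w ∷ R) (zero  , y) = fill w y ∷ R
erase (w ∷ R) (suc x , y) = w ∷ erase R (x , y)

fits : Region n → Tile → Bool
fits R = all (free R)

carve : Region n → Tile → Region n
carve = foldl erase

blank : Column → Bool
blank = all not

isBlank : Region n → Bool
isBlank []      = true
isBlank (w ∷ R) = blank w ∧ isBlank R

-- The number of sublists of the given tiles that partition the region: each tile in turn is either
-- used, if all its cells are still free, or skipped.
count : List Tile → Region n → ℕ
count []       R = if isBlank R then 1 else 0
count (t ∷ ts) R = (if fits R t then count ts (carve R t) else 0) + count ts R

-- Erasing cells

isFree-fill : ∀ w {y z} → T (isFree (fill w y) z) → T (isFree w z) × z ≢ y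
isFree-fill (_ ∷ w) {zero}  {suc z} f = f , λ ()
isFree-fill (_ ∷ w) {suc y} {zero}  f = f , λ ()
isFree-fill (_ ∷ w) {suc y} {suc z} f with g , z≢y ← isFree-fill w f = g , z≢y ∘ ℕₚ.suc-injective

fill-isFree : ∀ w {y z} → T (isFree w z) → z ≢ y → T (isFree (fill w y) z)
fill-isFree (_ ∷ w) {zero}  {zero}  f z≢y = contradiction refl z≢y
fill-isFree (_ ∷ w) {zero}  {suc z} f z≢y = f
fill-isFree (_ ∷ w) {suc y} {zero}  f z≢y = f
fill-isFree (_ ∷ w) {suc y} {suc z} f z≢y = fill-isFree w f (z≢y ∘ cong suc)

free-erase : ∀ (R : Region n) {c d} → T (free (erase R d) c) → T (free R c) × c ≢ d
free-erase (w ∷ R) {zero  , y} {zero  , z} f with g , y≢z ← isFree-fill w f = g , y≢z ∘ cong proj₂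
free-erase (w ∷ R) {zero  , y} {suc x , z} f = f , λ ()
free-erase (w ∷ R) {suc x , y} {zero  , z} f = f , λ ()
free-erase (w ∷ R) {suc x , y} {suc u , z} f with g , c≢d ← free-erase R f = g ,
  c≢d ∘ λ { refl → refl }

erase-free : ∀ (R : Region n) {c d} → T (free R c) → c ≢ d → T (free (erase R d) c)
erase-free (w ∷ R) {zero  , y} {zero  , z} f c≢d = fill-isFree w f (c≢d ∘ cong (0 ,_))
erase-free (w ∷ R) {zero  , y} {suc x , z} f c≢d = f
erase-free (w ∷ R) {suc x , y} {zero  , z} f c≢d = f
erase-free (w ∷ R) {suc x , y} {suc u , z} f c≢d = erase-free R f (c≢d ∘ cong (map₁ suc))

free-carve : ∀ (R : Region n) t {c} → T (free (carve R t) c) → T (free R c) × c ∉ t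
free-carve R []      f = f , λ ()
free-carve R (d ∷ t) f
  with g , c∉t ← free-carve (erase R d) t f
  with h , c≢d ← free-erase R g
  = h , λ { (here c≡d) → c≢d c≡d ; (there c∈t) → c∉t c∈t }

carve-free : ∀ (R : Region n) t {c} → T (free R c) → c ∉ t → T (free (carve R t) c)
carve-free R []      f c∉t = f
carve-free R (d ∷ t) f c∉t = carve-free (erase R d) t (erase-free R f (c∉t ∘ here)) (c∉t ∘ there)

fits⇒free : ∀ (R : Region n) t {c} → T (fits R t) → c ∈ t → T (free R c)
fits⇒free R t f = All.lookup (Allₚ.all⁺ (free R) t f)

free⇒fits : ∀ (R : Region n) t → (∀ {c} → c ∈ t → T (free R c)) → T (fits R t)
free⇒fits R t f = Allₚ.all⁻ (free R) (All.tabulate f)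

blank⇒¬isFree : ∀ w y → T (blank w) → ¬ T (isFree w y)
blank⇒¬isFree (false ∷ w) (suc y) b = blank⇒¬isFree w y b

¬isFree⇒blank : ∀ w → (∀ y → ¬ T (isFree w y)) → T (blank w)
¬isFree⇒blank []          _ = tt
¬isFree⇒blank (true  ∷ w) f = f 0 tt
¬isFree⇒blank (false ∷ w) f = ¬isFree⇒blank w (f ∘ suc)

isBlank⇒¬free : ∀ (R : Region n) c → T (isBlank R) → ¬ T (free R c)
isBlank⇒¬free (w ∷ R) (zero  , y) b = blank⇒¬isFree w y (proj₁ (to Boolₚ.T-∧ b))
isBlank⇒¬free (w ∷ R) (suc x , y) b = isBlank⇒¬free R (x , y) (proj₂ (to (Boolₚ.T-∧ {blank w}) b))

¬free⇒isBlank : ∀ (R : Region n) → (∀ c → ¬ T (free R c)) → T (isBlank R)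
¬free⇒isBlank []      _ = tt
¬free⇒isBlank (w ∷ R) f =
  from Boolₚ.T-∧ (¬isFree⇒blank w (f ∘ (0 ,_)) , ¬free⇒isBlank R (f ∘ map₁ suc))

-- Counting sublists

length-filter-map : ∀ {P : Pred Y p} (P? : Decidable P) (f : X → Y) xs →
  length (filter P? (map f xs)) ≡ length (filter (P? ∘ f) xs)
length-filter-map P? f []       = refl
length-filter-map P? f (x ∷ xs) with does (P? (f x))
... | true  = cong suc (length-filter-map P? f xs)
... | false = length-filter-map P? f xs

length-filter-sublists-∷ : ∀ {P : Pred (List X) p} (P? : Decidable P) x xs →
  length (filter P? (sublists (x ∷ xs))) ≡
  length (filter (P? ∘ (x ∷_)) (sublists xs)) + length (filter P? (sublists xs))
length-filter-sublists-∷ P? x xs = begin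
  length (filter P? (map (x ∷_) (sublists xs) ++ sublists xs))
    ≡⟨ cong length (Listₚ.filter-++ P? (map (x ∷_) (sublists xs)) (sublists xs)) ⟩
  length (filter P? (map (x ∷_) (sublists xs)) ++ filter P? (sublists xs))
    ≡⟨ Listₚ.length-++ (filter P? (map (x ∷_) (sublists xs))) ⟩
  length (filter P? (map (x ∷_) (sublists xs))) + length (filter P? (sublists xs))
    ≡⟨ cong (_+ _) (length-filter-map P? (x ∷_) (sublists xs)) ⟩
  length (filter (P? ∘ (x ∷_)) (sublists xs)) + length (filter P? (sublists xs)) ∎
  where open ≡-Reasoning

length-filter-none : ∀ {P : Pred X p} (P? : Decidable P) → (∀ x → ¬ P x) →
  ∀ xs → length (filter P? xs) ≡ 0
length-filter-none P? ¬P xs = cong length (Listₚ.filter-none P? (All.universal ¬P xs))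

-- Moves the restriction to tiles inside the board from the list of tiles into the predicate, so
-- that the recursion can run over all translates.
length-filter-sublists-filter : ∀ {P : Pred (List X) p} {Q : Pred X q}
  (P? : Decidable P) (Q? : Decidable Q) xs →
  length (filter P? (sublists (filter Q? xs))) ≡
  length (filter (λ U → All.all? Q? U ×-dec P? U) (sublists xs))
length-filter-sublists-filter P? Q? []       with does (P? [])
... | true  = refl
... | false = refl
length-filter-sublists-filter {P = P} {Q} P? Q? (x ∷ xs) =
  trans lemma (sym (length-filter-sublists-∷ (λ U → All.all? Q? U ×-dec P? U) x xs))
  where
  open ≡-Reasoning
  lemma : length (filter P? (sublists (filter Q? (x ∷ xs)))) ≡
    length (filter (λ U → All.all? Q? (x ∷ U) ×-dec P? (x ∷ U)) (sublists xs)) +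
    length (filter (λ U → All.all? Q? U ×-dec P? U) (sublists xs))
  lemma with Q? x
  ... | yes Qx = begin
    length (filter P? (sublists (x ∷ filter Q? xs)))
      ≡⟨ length-filter-sublists-∷ P? x (filter Q? xs) ⟩
    length (filter (P? ∘ (x ∷_)) (sublists (filter Q? xs))) + length (filter P? (sublists (filter Q? xs)))
      ≡⟨ cong₂ _+_ (length-filter-sublists-filter (P? ∘ (x ∷_)) Q? xs)
                   (length-filter-sublists-filter P? Q? xs) ⟩
    length (filter (λ U → All.all? Q? U ×-dec P? (x ∷ U)) (sublists xs)) + _
      ≡⟨ cong (λ l → length l + _)
           (Listₚ.filter-≐ _ _ ((λ (Qs , Ps) → Qx ∷ Qs , Ps) , λ (Qs , Ps) → All.tail Qs , Ps)
              (sublists xs)) ⟩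
    _ ∎
  ... | no ¬Qx = begin
    length (filter P? (sublists (filter Q? xs)))
      ≡⟨ length-filter-sublists-filter P? Q? xs ⟩
    length (filter (λ U → All.all? Q? U ×-dec P? U) (sublists xs))
      ≡⟨ cong (_+ _) (length-filter-none _ (λ _ (Qs , _) → ¬Qx (All.head Qs)) (sublists xs)) ⟨
    _ ∎

-- Partitions of a region

Partitions : Region n → List Tile → Set
Partitions R U =
  AllPairs Disjoint U × All (T ∘ fits R) U × (∀ c → T (free R c) → Any (c ∈_) U)

isBlank⇔partitions-[] : (R : Region n) → T (isBlank R) ⇔ Partitions R []
isBlank⇔partitions-[] R = mk⇔
  (λ b → [] , [] , λ c f → contradiction f (isBlank⇒¬free R c b))
  (λ (_ , _ , cover) → ¬free⇒isBlank R λ c f → contradiction (cover c f) λ ())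

-- For tiles that fit `R`, being disjoint from `t` is the same as still fitting once `t` is removed;
-- and the free cells outside `t` can only be covered by `U`.
partitions-carve : ∀ (R : Region n) {t U} → T (fits R t) → Partitions R (t ∷ U) ⇔ Partitions (carve R t) U
partitions-carve R {t} {U} fit = mk⇔ remove add
  where
  remove : Partitions R (t ∷ U) → Partitions (carve R t) U
  remove (d ∷ ds , _ ∷ fs , cover) = ds , All.zipWith (λ {u} → still-fits u) (d , fs) , cover′
    where
    still-fits : ∀ u → Disjoint t u × T (fits R u) → T (fits (carve R t) u)
    still-fits u (d , f) = free⇒fits (carve R t) u λ c∈u →
      carve-free R t (fits⇒free R u f c∈u) λ c∈t → d (c∈t , c∈u)
    cover′ : ∀ c → T (free (carve R t) c) → Any (c ∈_) U
    cover′ c f with fR , c∉t ← free-carve R t f with cover c fR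
    ... | here c∈t = contradiction c∈t c∉t
    ... | there c∈ = c∈
  add : Partitions (carve R t) U → Partitions R (t ∷ U)
  add (ds , fs , cover) =
    All.map (λ {u} → disjoint u) fs ∷ ds , fit ∷ All.map (λ {u} → fitted u) fs , cover′
    where
    disjoint : ∀ u → T (fits (carve R t) u) → Disjoint t u
    disjoint u f (c∈t , c∈u) = proj₂ (free-carve R t (fits⇒free (carve R t) u f c∈u)) c∈t
    fitted : ∀ u → T (fits (carve R t) u) → T (fits R u)
    fitted u f = free⇒fits R u λ c∈u → proj₁ (free-carve R t (fits⇒free (carve R t) u f c∈u))
    cover′ : ∀ c → T (free R c) → Any (c ∈_) (t ∷ U)
    cover′ c f with c ∈? t
    ... | yes c∈t = here c∈t
    ... | no  c∉t = there (cover c (carve-free R t f c∉t))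

-- Induction on `ts`. The predicate is only required to be equivalent to `Partitions R`, so that
-- `P? ∘ (t ∷_)` again qualifies, now for `carve R t`.
length-filter-partitions : ∀ ts (R : Region n) {P : Pred (List Tile) p} (P? : Decidable P) →
  (∀ U → P U ⇔ Partitions R U) → length (filter P? (sublists ts)) ≡ count ts R
length-filter-partitions [] R P? P⇔ with P? [] | isBlank R in eq
... | yes _  | true  = refl
... | no  _  | false = refl
... | yes Pø | false = ⊥-elim (subst T eq (from (isBlank⇔partitions-[] R) (to (P⇔ []) Pø)))
... | no ¬Pø | true  = contradiction (from (P⇔ []) (to (isBlank⇔partitions-[] R) (from Boolₚ.T-≡ eq))) ¬Pø
length-filter-partitions (t ∷ ts) R P? P⇔ =
  trans (length-filter-sublists-∷ P? t ts)
        (cong₂ _+_ withTile (length-filter-partitions ts R P? P⇔))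
  where
  withTile : length (filter (P? ∘ (t ∷_)) (sublists ts)) ≡ (if fits R t then count ts (carve R t) else 0)
  withTile with fits R t in eq
  ... | true  = length-filter-partitions ts (carve R t) (P? ∘ (t ∷_))
                  λ U → Composition.equivalence (P⇔ (t ∷ U)) (partitions-carve R (from Boolₚ.T-≡ eq))
  ... | false = length-filter-none (P? ∘ (t ∷_))
                  (λ U PtU → subst T eq (All.head (proj₁ (proj₂ (to (P⇔ (t ∷ U)) PtU)))))
                  (sublists ts)

-- Tilings of the board as partitions of the full region

full : ℕ → Column
full k = List.replicate k true

free-full : ∀ k n {c} → T (free (replicate n (full k)) c) ⇔ c ∈ board k n
free-full k n {c} = mk⇔
  (λ f → let x<n , y<k = bounds n c f in
    ∈-cartesianProduct⁺ (∈-upTo⁺ x<n) (∈-upTo⁺ y<k))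
  (λ c∈ → let x∈ , y∈ = ∈-cartesianProduct⁻ (upTo n) (upTo k) c∈ in
    inside n c (∈-upTo⁻ x∈) (∈-upTo⁻ y∈))
  where
  boundsColumn : ∀ k y → T (isFree (full k) y) → y < k
  boundsColumn (suc k) zero    _ = z<s
  boundsColumn (suc k) (suc y) f = s<s (boundsColumn k y f)
  bounds : ∀ n c → T (free (replicate n (full k)) c) → proj₁ c < n × proj₂ c < k
  bounds (suc n) (zero  , y) f = z<s , boundsColumn k y f
  bounds (suc n) (suc x , y) f = map₁ s<s (bounds n (x , y) f)
  insideColumn : ∀ k y → y < k → T (isFree (full k) y)
  insideColumn (suc k) zero    _         = tt
  insideColumn (suc k) (suc y) (s<s y<k) = insideColumn k y y<k
  inside : ∀ n c → proj₁ c < n → proj₂ c < k → T (free (replicate n (full k)) c)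
  inside (suc n) (zero  , y) _         y<k = insideColumn k y y<k
  inside (suc n) (suc x , y) (s<s x<n) y<k = inside n (x , y) x<n y<k

translates : (k n : ℕ) → List Tile
translates k n = cartesianProductWith translate (board k n) L-tetrominoes

numTilings≡count : ∀ k n → numTilings k n ≡ count (translates k n) (replicate n (full k))
numTilings≡count k n =
  trans (length-filter-sublists-filter (isTiling? k n) (All.all? (_∈? board k n)) (translates k n))
        (length-filter-partitions (translates k n) R _ tiling⇔partitions)
  where
  R : Region n
  R = replicate n (full k)
  tiling⇔partitions : ∀ U → (All (All (_∈ board k n)) U × IsTiling k n U) ⇔ Partitions R U
  tiling⇔partitions U = mk⇔
    (λ (inside , ds , cover) →
      ds ,
      All.map (λ {t} t⊆ → free⇒fits R t (from (free-full k n) ∘ All.lookup t⊆)) inside ,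
      λ c f → All.lookup cover (to (free-full k n) f))
    (λ (ds , fs , cover) →
      All.map (λ {t} f → All.tabulate (to (free-full k n) ∘ fits⇒free R t f)) fs ,
      ds ,
      All.tabulate (λ {c} c∈ → cover c (from (free-full k n) c∈)))

-- Peeling off the first column

∑ : (X → ℕ) → List X → ℕ
∑ f xs = sum (map f xs)

∑-++ : ∀ (f : X → ℕ) xs ys → ∑ f (xs ++ ys) ≡ ∑ f xs + ∑ f ys
∑-++ f xs ys = trans (cong sum (Listₚ.map-++ f xs ys)) (sum-++ (map f xs) (map f ys))

∑-cong : {f g : X → ℕ} → f ≗ g → ∑ f ≗ ∑ g
∑-cong f≗g xs = cong sum (Listₚ.map-cong f≗g xs)

∑-concatMap : ∀ (f : Y → ℕ) (g : X → List Y) xs → ∑ f (concatMap g xs) ≡ ∑ (∑ f ∘ g) xs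
∑-concatMap f g []       = refl
∑-concatMap f g (x ∷ xs) =
  trans (∑-++ f (g x) (concatMap g xs)) (cong (∑ f (g x) ℕ.+_) (∑-concatMap f g xs))

∑-filterᵇ : ∀ (f : X → ℕ) b xs → ∑ f (filterᵇ b xs) ≡ ∑ (λ x → if b x then f x else 0) xs
∑-filterᵇ f b []       = refl
∑-filterᵇ f b (x ∷ xs) with b x
... | true  = cong (f x ℕ.+_) (∑-filterᵇ f b xs)
... | false = ∑-filterᵇ f b xs

-- The recursion of `count`, but recording the remaining regions, with multiplicity, instead of
-- testing them for blankness.
moves : List Tile → Region n → List (Region n)
moves []       R = R ∷ []
moves (t ∷ ts) R = (if fits R t then moves ts (carve R t) else []) ++ moves ts R

anchoredAt : ℕ → List Tile
anchoredAt v = map (translate (0 , v)) L-tetrominoes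

-- Once all tiles with translation vectors up to (0 , v) have been
-- considered, no tile can cover the cell (0 , v) any more.
columnMoves : List ℕ → Region n → List (Region n)
columnMoves []       R = R ∷ []
columnMoves (v ∷ vs) R =
  concatMap (columnMoves vs) (filterᵇ (λ R′ → not (free R′ (0 , v))) (moves (anchoredAt v) R))

next : ℕ → Region (suc n) → List (Region n)
next k R = map Vec.tail (filterᵇ (blank ∘ Vec.head) (columnMoves (upTo k) R))

tilings : ℕ → Region n → ℕ
tilings {zero}  _ _ = 1
tilings {suc n} k R = ∑ (tilings k) (next k R)

∑-moves : ∀ ts us (R : Region n) → ∑ (count us) (moves ts R) ≡ count (ts ++ us) R
∑-moves []       us R = ℕₚ.+-identityʳ (count us R)
∑-moves (t ∷ ts) us R with fits R t
... | true  = trans (∑-++ (count us) (moves ts (carve R t)) (moves ts R))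
                    (cong₂ _+_ (∑-moves ts us (carve R t)) (∑-moves ts us R))
... | false = ∑-moves ts us R

-- Justifies the pruning in `columnMoves`: a free cell that lies in none of the remaining tiles
-- stays free to the end.
count-uncoverable : ∀ ts (R : Region n) {c} → T (free R c) → All (c ∉_) ts → count ts R ≡ 0
count-uncoverable []       R {c} f [] with isBlank R in eq
... | true  = contradiction f (isBlank⇒¬free R c (from Boolₚ.T-≡ eq))
... | false = refl
count-uncoverable (t ∷ ts) R f (c∉t ∷ c∉ts) with fits R t
... | true  = cong₂ _+_ (count-uncoverable ts (carve R t) (carve-free R t f c∉t) c∉ts)
                        (count-uncoverable ts R f c∉ts)
... | false = count-uncoverable ts R f c∉ts

anchoredAt-above : ∀ {v w} → v < w → All ((0 , v) ∉_) (anchoredAt w)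
anchoredAt-above {v} {w} v<w = Allₚ.map⁺ (All.universal above L-tetrominoes)
  where
  above : ∀ t → (0 , v) ∉ translate (0 , w) t
  above t c∈ with (x , y) , _ , eq ← ∈-map⁻ _ c∈ =
    ℕₚ.<⇒≱ v<w (subst (w ℕ.≤_) (sym (cong proj₂ eq)) (ℕₚ.m≤m+n w y))

-- Once the tiles anchored at `(0 , v)` are decided, that cell is out of reach: the later anchors in
-- the column are higher, and the tiles in `us` avoid the first column. So the regions that the
-- filter discards contribute zero.
∑-columnMoves : ∀ {vs us} → AllPairs _<_ vs → (∀ v → All ((0 , v) ∉_) us) → (R : Region n) →
  ∑ (count us) (columnMoves vs R) ≡ count (concatMap anchoredAt vs ++ us) R
∑-columnMoves {us = us} [] _ R = ℕₚ.+-identityʳ (count us R)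
∑-columnMoves {vs = v ∷ vs} {us} (v< ∷ <vs) v∉us R = begin
  ∑ (count us) (concatMap (columnMoves vs) (filterᵇ settled (moves (anchoredAt v) R)))
    ≡⟨ ∑-concatMap (count us) (columnMoves vs) (filterᵇ settled (moves (anchoredAt v) R)) ⟩
  ∑ (∑ (count us) ∘ columnMoves vs) (filterᵇ settled (moves (anchoredAt v) R))
    ≡⟨ ∑-cong (∑-columnMoves <vs v∉us) (filterᵇ settled (moves (anchoredAt v) R)) ⟩
  ∑ (count later) (filterᵇ settled (moves (anchoredAt v) R))
    ≡⟨ ∑-filterᵇ (count later) settled (moves (anchoredAt v) R) ⟩
  ∑ (λ R′ → if settled R′ then count later R′ else 0) (moves (anchoredAt v) R)
    ≡⟨ ∑-cong drop-unsettled (moves (anchoredAt v) R) ⟩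
  ∑ (count later) (moves (anchoredAt v) R)
    ≡⟨ ∑-moves (anchoredAt v) later R ⟩
  count (anchoredAt v ++ later) R
    ≡⟨ cong (λ ts → count ts R) (Listₚ.++-assoc (anchoredAt v) (concatMap anchoredAt vs) us) ⟨
  count ((anchoredAt v ++ concatMap anchoredAt vs) ++ us) R ∎
  where
  open ≡-Reasoning
  settled : Region _ → Bool
  settled R′ = not (free R′ (0 , v))
  later : List Tile
  later = concatMap anchoredAt vs ++ us
  drop-unsettled : ∀ R′ → (if settled R′ then count later R′ else 0) ≡ count later R′
  drop-unsettled R′ with free R′ (0 , v) in eq
  ... | false = refl
  ... | true  = sym (count-uncoverable later R′ (from Boolₚ.T-≡ eq)
                  (Allₚ.++⁺ (Allₚ.concat⁺ (Allₚ.map⁺ (All.map anchoredAt-above v<))) (v∉us v)))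

shift : Tile → Tile
shift = map (map₁ suc)

fits-shift : ∀ w (R : Region n) t → fits (w ∷ R) (shift t) ≡ fits R t
fits-shift w R []      = refl
fits-shift w R (c ∷ t) = cong (free R c ∧_) (fits-shift w R t)

carve-shift : ∀ w (R : Region n) t → carve (w ∷ R) (shift t) ≡ w ∷ carve R t
carve-shift w R []      = refl
carve-shift w R (c ∷ t) = carve-shift w (erase R c) t

-- Shifted tiles never touch the first column, so whatever is free in `w` remains uncovered.
count-shift : ∀ ts (w : Column) (R : Region n) →
  count (map shift ts) (w ∷ R) ≡ (if blank w then count ts R else 0)
count-shift [] w R with blank w
... | true  = refl
... | false = refl
count-shift (t ∷ ts) w R rewrite fits-shift w R t | carve-shift w R t
                               | count-shift ts w R with fits R t
... | false = refl
... | true rewrite count-shift ts w (carve R t) with blank w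
...   | true  = refl
...   | false = refl

board-suc : ∀ k n → board k (suc n) ≡ map (0 ,_) (upTo k) ++ map (map₁ suc) (board k n)
board-suc k n = cong (map (0 ,_) (upTo k) ++_)
  (trans (cong (λ xs → cartesianProduct xs (upTo k)) (sym (Listₚ.map-upTo suc n)))
         (rest (upTo n)))
  where
  rest : ∀ xs → cartesianProduct (map suc xs) (upTo k) ≡ map (map₁ suc) (cartesianProduct xs (upTo k))
  rest []       = refl
  rest (x ∷ xs) = trans (cong₂ _++_ (Listₚ.map-∘ (upTo k)) (rest xs))
                        (sym (Listₚ.map-++ (map₁ suc) (map (x ,_) (upTo k)) _))

-- `board` lists its cells column by column, so the tiles anchored in the first column already come
-- first and no reordering of tiles is needed.
translates-suc : ∀ k n →
  translates k (suc n) ≡ concatMap anchoredAt (upTo k) ++ map shift (translates k n)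
translates-suc k n = begin
  translatesOf (board k (suc n))
    ≡⟨ cong translatesOf (board-suc k n) ⟩
  translatesOf (map (0 ,_) (upTo k) ++ map (map₁ suc) (board k n))
    ≡⟨ Listₚ.cartesianProductWith-distribʳ-++ translate (map (0 ,_) (upTo k)) _ L-tetrominoes ⟩
  translatesOf (map (0 ,_) (upTo k)) ++ translatesOf (map (map₁ suc) (board k n))
    ≡⟨ cong₂ _++_ (first (upTo k)) (rest (board k n)) ⟩
  concatMap anchoredAt (upTo k) ++ map shift (translates k n) ∎
  where
  open ≡-Reasoning
  translatesOf : List Cell → List Tile
  translatesOf cs = cartesianProductWith translate cs L-tetrominoes
  first : ∀ vs → translatesOf (map (0 ,_) vs) ≡ concatMap anchoredAt vs
  first []       = refl
  first (v ∷ vs) = cong (anchoredAt v ++_) (first vs)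
  rest : ∀ cs → translatesOf (map (map₁ suc) cs) ≡ map shift (translatesOf cs)
  rest []       = refl
  rest (c ∷ cs) = cong (map (translate (map₁ suc c)) L-tetrominoes ++_) (rest cs)

shift-right : ∀ v ts → All ((0 , v) ∉_) (map shift ts)
shift-right v ts = Allₚ.map⁺ (All.universal (λ t c∈ → case (∈-map⁻ _ c∈)) ts)
  where
  case : ∀ {t} → (Σ[ c ∈ Cell ] (c ∈ t × (0 , v) ≡ map₁ suc c)) → ⊥
  case (_ , _ , ())

tilings≡count : ∀ k (R : Region n) → tilings k R ≡ count (translates k n) R
tilings≡count {zero}  k [] = refl
tilings≡count {suc n} k R = begin
  ∑ (tilings k) (next k R)
    ≡⟨ ∑-cong (tilings≡count k) (next k R) ⟩
  ∑ (count ts) (map Vec.tail (filterᵇ (blank ∘ Vec.head) (columnMoves (upTo k) R)))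
    ≡⟨ cong sum (Listₚ.map-∘ (filterᵇ (blank ∘ Vec.head) (columnMoves (upTo k) R))) ⟨
  ∑ (count ts ∘ Vec.tail) (filterᵇ (blank ∘ Vec.head) (columnMoves (upTo k) R))
    ≡⟨ ∑-filterᵇ (count ts ∘ Vec.tail) (blank ∘ Vec.head) (columnMoves (upTo k) R) ⟩
  ∑ (λ R′ → if blank (Vec.head R′) then count ts (Vec.tail R′) else 0) (columnMoves (upTo k) R)
    ≡⟨ ∑-cong (λ { (w ∷ R′) → count-shift ts w R′ }) (columnMoves (upTo k) R) ⟨
  ∑ (count (map shift ts)) (columnMoves (upTo k) R)
    ≡⟨ ∑-columnMoves (AllPairsₚ.applyUpTo⁺₁ _ k (λ i<j _ → i<j)) (λ v → shift-right v ts) R ⟩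
  count (concatMap anchoredAt (upTo k) ++ map shift ts) R
    ≡⟨ cong (λ us → count us R) (translates-suc k n) ⟨
  count (translates k (suc n)) R ∎
  where
  open ≡-Reasoning
  ts : List Tile
  ts = translates k n

numTilings≡tilings : ∀ k n → numTilings k n ≡ tilings k (replicate n (full k))
numTilings≡tilings k n = trans (numTilings≡count k n) (sym (tilings≡count k (replicate n (full k))))

-- Locality of the column step

Within : ℕ → Tile → Set
Within m = All (λ c → proj₁ c < m)

free-++ : ∀ (S : Region m) (R : Region n) {c} → proj₁ c < m → free (S Vec.++ R) c ≡ free S c
free-++ (w ∷ S) R {zero  , y} _         = refl
free-++ (w ∷ S) R {suc x , y} (s<s x<m) = free-++ S R x<m

erase-++ : ∀ (S : Region m) (R : Region n) {c} → proj₁ c < m → erase (S Vec.++ R) c ≡ erase S c Vec.++ R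
erase-++ (w ∷ S) R {zero  , y} _         = refl
erase-++ (w ∷ S) R {suc x , y} (s<s x<m) = cong (w ∷_) (erase-++ S R x<m)

fits-++ : ∀ (S : Region m) (R : Region n) {t} → Within m t → fits (S Vec.++ R) t ≡ fits S t
fits-++ S R []        = refl
fits-++ S R (c< ∷ t<) = cong₂ _∧_ (free-++ S R c<) (fits-++ S R t<)

carve-++ : ∀ (S : Region m) (R : Region n) {t} → Within m t → carve (S Vec.++ R) t ≡ carve S t Vec.++ R
carve-++ S R []        = refl
carve-++ S R {c ∷ t} (c< ∷ t<) =
  trans (cong (λ S′ → carve S′ t) (erase-++ S R c<)) (carve-++ (erase S c) R t<)

moves-++ : ∀ {ts} → All (Within m) ts → (S : Region m) (R : Region n) →
  moves ts (S Vec.++ R) ≡ map (Vec._++ R) (moves ts S)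
moves-++ []        S R = refl
moves-++ {ts = t ∷ ts} (t< ∷ ts<) S R rewrite fits-++ S R t< | carve-++ S R t< with fits S t
... | true  = trans (cong₂ _++_ (moves-++ ts< (carve S t) R) (moves-++ ts< S R))
                    (sym (Listₚ.map-++ (Vec._++ R) (moves ts (carve S t)) (moves ts S)))
... | false = moves-++ ts< S R

filterᵇ-map : ∀ {X Y : Set} {p : Y → Bool} {q : X → Bool} (f : X → Y) → p ∘ f ≗ q →
  ∀ xs → filterᵇ p (map f xs) ≡ map f (filterᵇ q xs)
filterᵇ-map f pf≗q []       = refl
filterᵇ-map {q = q} f pf≗q (x ∷ xs) rewrite pf≗q x with q x
... | true  = cong (f x ∷_) (filterᵇ-map f pf≗q xs)
... | false = filterᵇ-map f pf≗q xs

anchoredAt-within : ∀ v → All (Within (3 + m)) (anchoredAt v)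
anchoredAt-within v =
    (z<s ∷ z<s ∷ z<s ∷ s<s z<s ∷ [])
  ∷ (z<s ∷ z<s ∷ s<s z<s ∷ s<s (s<s z<s) ∷ [])
  ∷ (z<s ∷ s<s z<s ∷ s<s (s<s z<s) ∷ s<s (s<s z<s) ∷ [])
  ∷ (z<s ∷ s<s z<s ∷ s<s z<s ∷ s<s z<s ∷ [])
  ∷ []

columnMoves-++ : ∀ vs (S : Region (3 + m)) (R : Region n) →
  columnMoves vs (S Vec.++ R) ≡ map (Vec._++ R) (columnMoves vs S)
columnMoves-++ []       S R = refl
columnMoves-++ (v ∷ vs) S R = begin
  concatMap (columnMoves vs) (filterᵇ settled (moves (anchoredAt v) (S Vec.++ R)))
    ≡⟨ cong (concatMap (columnMoves vs) ∘ filterᵇ settled) (moves-++ (anchoredAt-within v) S R) ⟩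
  concatMap (columnMoves vs) (filterᵇ settled (map (Vec._++ R) (moves (anchoredAt v) S)))
    ≡⟨ cong (concatMap (columnMoves vs))
         (filterᵇ-map (Vec._++ R) (λ S → cong not (free-++ S R {0 , v} z<s)) (moves (anchoredAt v) S)) ⟩
  concatMap (columnMoves vs) (map (Vec._++ R) Ss)
    ≡⟨ Listₚ.concatMap-map (columnMoves vs) (Vec._++ R) Ss ⟩
  concatMap (columnMoves vs ∘ (Vec._++ R)) Ss
    ≡⟨ Listₚ.concatMap-cong (λ S → columnMoves-++ vs S R) Ss ⟩
  concatMap (map (Vec._++ R) ∘ columnMoves vs) Ss
    ≡⟨ Listₚ.map-concatMap (Vec._++ R) (columnMoves vs) Ss ⟨
  map (Vec._++ R) (concatMap (columnMoves vs) Ss) ∎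
  where
  open ≡-Reasoning
  settled : Region n → Bool
  settled R′ = not (free R′ (0 , v))
  Ss : List (Region _)
  Ss = filterᵇ settled (moves (anchoredAt v) S)

-- No L-tetromino is wider than three columns, so a step that uses tiles anchored in the first
-- column hands on everything behind the third unchanged.
next-++ : ∀ k (S : Region (3 + m)) (R : Region n) → next k (S Vec.++ R) ≡ map (Vec._++ R) (next k S)
next-++ k S R = begin
  map Vec.tail (filterᵇ (blank ∘ Vec.head) (columnMoves (upTo k) (S Vec.++ R)))
    ≡⟨ cong (map Vec.tail ∘ filterᵇ (blank ∘ Vec.head)) (columnMoves-++ (upTo k) S R) ⟩
  map Vec.tail (filterᵇ (blank ∘ Vec.head) (map (Vec._++ R) (columnMoves (upTo k) S)))
    ≡⟨ cong (map Vec.tail) (filterᵇ-map (Vec._++ R) (λ { (w ∷ _) → refl }) (columnMoves (upTo k) S)) ⟩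
  map Vec.tail (map (Vec._++ R) Ss)  ≡⟨ Listₚ.map-∘ Ss ⟨
  map (Vec.tail ∘ (Vec._++ R)) Ss    ≡⟨ Listₚ.map-cong (λ { (w ∷ _) → refl }) Ss ⟩
  map ((Vec._++ R) ∘ Vec.tail) Ss    ≡⟨ Listₚ.map-∘ Ss ⟩
  map (Vec._++ R) (map Vec.tail Ss)  ∎
  where
  open ≡-Reasoning
  Ss : List (Region _)
  Ss = filterᵇ (blank ∘ Vec.head) (columnMoves (upTo k) S)

-- Frontiers

-- The first two columns of a region whose further columns are full.
Frontier : Set
Frontier = Region 2

_≟ᶠ_ : DecidableEquality Frontier
_≟ᶠ_ = Vecₚ.≡-dec (Listₚ.≡-dec Boolₚ._≟_)

extend : ∀ k n → Frontier → Region (2 + n)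
extend k n s = s Vec.++ replicate n (full k)

completions : ∀ k n → Frontier → ℕ
completions k n = tilings k ∘ extend k n

-- One full column is appended because tiles anchored in the first column may reach the third;
-- dropping the first column then leaves a frontier again.
successors : ℕ → Frontier → List Frontier
successors k s = next k (s Vec.++ full k ∷ [])

fullFrontier : ℕ → Frontier
fullFrontier k = full k ∷ full k ∷ []

completions-full : ∀ k n {N} → 2 + n ≡ N → completions k n (fullFrontier k) ≡ numTilings k N
completions-full k n refl = sym (numTilings≡tilings k (2 + n))

completions-suc : ∀ k n s → completions k (suc n) s ≡ ∑ (completions k n) (successors k s)
completions-suc k n s@(_ ∷ _ ∷ []) =
  cong sum (trans (cong (map (tilings k)) (next-++ k (s Vec.++ full k ∷ []) (replicate n (full k))))
                  (sym (Listₚ.map-∘ (successors k s))))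

-- Linear relations between terms of a sequence

-- Surplus entries on either side are ignored, so `dot cs (applyDownFrom x (suc n))` is the
-- coefficient at `n` of a product of power series for every `n`, small or large.
dot : List ℤ → List ℤ → ℤ
dot (c ∷ cs) (x ∷ xs) = c ℤ.* x ℤ.+ dot cs xs
dot _        _        = 0ℤ

-- Satisfies cs α xs says that the product of the power series with
-- coefficients cs and (in decreasing order of degree) xs agrees with α as
-- far as xs determines it.
Satisfies : List ℤ → (ℕ → ℤ) → List ℤ → Set
Satisfies cs α []       = ⊤
Satisfies cs α (x ∷ xs) = dot cs (x ∷ xs) ≡ α (length xs) × Satisfies cs α xs

satisfies? : ∀ cs α xs → Dec (Satisfies cs α xs)
satisfies? cs α []       = yes tt
satisfies? cs α (x ∷ xs) = dot cs (x ∷ xs) ℤₚ.≟ α (length xs) ×-dec satisfies? cs α xs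

satisfies-lookup : ∀ cs α (x : ℕ → ℤ) {n N} → n < N → Satisfies cs α (applyDownFrom x N) →
  dot cs (applyDownFrom x (suc n)) ≡ α n
satisfies-lookup cs α x {n} {suc N} n<1+N (eq , rest) with n ℕₚ.≟ N
... | yes refl = trans eq (cong α (Listₚ.length-applyDownFrom x N))
... | no  n≢N  = satisfies-lookup cs α x (ℕₚ.≤∧≢⇒< (ℕₚ.≤-pred n<1+N) n≢N) rest

dot-zero : ∀ {O : Set} cs (os : List O) → dot cs (map (λ _ → 0ℤ) os) ≡ 0ℤ
dot-zero []       os       = refl
dot-zero (c ∷ cs) []       = refl
dot-zero (c ∷ cs) (o ∷ os) = cong₂ ℤ._+_ (ℤₚ.*-zeroʳ c) (dot-zero cs os)

dot-+ : ∀ {O : Set} cs (f g : O → ℤ) os →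
  dot cs (map (λ o → f o ℤ.+ g o) os) ≡ dot cs (map f os) ℤ.+ dot cs (map g os)
dot-+ []       f g os       = refl
dot-+ (c ∷ cs) f g []       = refl
dot-+ (c ∷ cs) f g (o ∷ os) =
  trans (cong₂ ℤ._+_ (ℤₚ.*-distribˡ-+ c (f o) (g o)) (dot-+ cs f g os))
        (interchange ℤₚ.+-commutativeSemigroup (c ℤ.* f o) (c ℤ.* g o)
          (dot cs (map f os)) (dot cs (map g os)))

-- Linearity of the relation; this is what carries it from the successors of a frontier to the
-- frontier itself.
dot-∑ : ∀ {O X : Set} cs (f : O → X → ℕ) os {xs} →
  All (λ x → dot cs (map (λ o → + f o x) os) ≡ 0ℤ) xs → dot cs (map (λ o → + ∑ (f o) xs) os) ≡ 0ℤ
dot-∑ cs f os []                  = dot-zero cs os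
dot-∑ cs f os {x ∷ xs} (eq ∷ eqs) =
  trans (dot-+ cs (λ o → + f o x) (λ o → + ∑ (f o) xs) os) (cong₂ ℤ._+_ eq (dot-∑ cs f os eqs))

-- `dot` reads only the first `length cs` entries, here those of highest index, and these agree on
-- both sides.
dot-applyDownFrom : ∀ cs (f : ℕ → ℤ) m {n} → length cs ℕ.≤ n →
  dot cs (applyDownFrom (λ i → f (i + m)) n) ≡ dot cs (applyDownFrom f (n + m))
dot-applyDownFrom []       f m _       = refl
dot-applyDownFrom (c ∷ cs) f m {suc n} (s≤s l≤n) =
  cong (λ y → c ℤ.* f (n + m) ℤ.+ y) (dot-applyDownFrom cs f m l≤n)

-- Transition tables

-- The i-th row lists the positions, in a second list of frontiers, of the
-- successors of the i-th frontier of a first list.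
Table : Set
Table = List (List ℕ)

-- A sequence of tables, each with its target list.
Chain : Set
Chain = List (Table × List Frontier)

nth : ∀ {X : Set} → List X → ℕ → Maybe X
nth xs i = List.head (List.drop i xs)

pull : Table → List ℕ → List ℕ
pull T v = map (∑ λ i → fromMaybe 0 (nth v i)) T

pulls : Chain → List ℕ → List ℕ
pulls []             v = v
pulls ((T , _) ∷ ch) v = pull T (pulls ch v)

prolong : Chain → List (List ℕ) → List (List ℕ)
prolong ch []       = []
prolong ch (v ∷ vs) = pulls ch v ∷ v ∷ vs

orbit : Chain → List ℕ → ℕ → List (List ℕ)
orbit ch v zero    = v ∷ []
orbit ch v (suc n) = prolong ch (orbit ch v n)

-- `dot` in all coordinates at once, one for each frontier in `S`.
combination : List ℤ → List (List ℕ) → List Frontier → List ℤ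
combination (c ∷ cs) (v ∷ vs) S = List.zipWith (λ x y → c ℤ.* + x ℤ.+ y) v (combination cs vs S)
combination _        _        S = map (λ _ → 0ℤ) S

-- An absent frontier gets the position `length S`, past the end, which makes `ValidRow` fail.
indexOf : List Frontier → Frontier → ℕ
indexOf []      s = 0
indexOf (t ∷ S) s = if does (s ≟ᶠ t) then 0 else suc (indexOf S s)

-- The target list is bound once, to be shared between the table and the rest of the chain.
link : List (List Frontier) → (List Frontier → Chain) → List Frontier → Chain
link rows rest S = (map (map (indexOf S)) rows , S) ∷ rest S

-- Intermediate targets consist of the successors that occur; the last table points into the
-- prescribed list `E`, so that a chain from a list to itself can close up.
chainFrom : ℕ → ℕ → List (List Frontier) → List Frontier → Chain
chainFrom k zero          rows E = []
chainFrom k (suc zero)    rows E = link rows (λ _ → []) E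
chainFrom k (suc (suc n)) rows E =
  link rows (λ S → chainFrom k (suc n) (map (successors k) S) E)
       (List.deduplicate _≟ᶠ_ (List.concat rows))

chain : ℕ → ℕ → List Frontier → List Frontier → Chain
chain k n S E = chainFrom k n (map (successors k) S) E

reachable : ℕ → ℕ → List Frontier
reachable k zero    = fullFrontier k ∷ []
reachable k (suc n) = List.deduplicate _≟ᶠ_ (concatMap (successors k) (reachable k n))

nth-map : ∀ {X Y : Set} (f : X → Y) xs i → nth (map f xs) i ≡ Maybe.map f (nth xs i)
nth-map f xs i = trans (cong List.head (Listₚ.drop-map i xs)) (Listₚ.head-map (List.drop i xs))

All-nth : ∀ {X : Set} {P : X → Set} {xs} → All P xs → ∀ i → MaybeAll.All P (nth xs i)
All-nth []       zero    = nothing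
All-nth []       (suc i) = nothing
All-nth (p ∷ ps) zero    = just p
All-nth (p ∷ ps) (suc i) = All-nth ps i

module _ (k : ℕ) where

  ValidRow : List Frontier → Frontier → List ℕ → Set
  ValidRow S s is = map (nth S) is ≡ map just (successors k s)

  -- Validity is decided by comparison with the successors, so nothing has to be proved about how
  -- `chainFrom` builds the tables.
  Valid : List Frontier → Chain → List Frontier → Set
  Valid S []              E = S ≡ E
  Valid S ((T , S′) ∷ ch) E = Pointwise (ValidRow S′) S T × Valid S′ ch E

  valid? : ∀ S ch E → Dec (Valid S ch E)
  valid? S []              E = Listₚ.≡-dec _≟ᶠ_ S E
  valid? S ((T , S′) ∷ ch) E = Pointwise.decidable validRow? S T ×-dec valid? S′ ch E
    where
    validRow? : ∀ s is → Dec (ValidRow S′ s is)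
    validRow? s is = Listₚ.≡-dec (Maybeₚ.≡-dec _≟ᶠ_) (map (nth S′) is) (map just (successors k s))

  ∑-row : ∀ S s {is} → ValidRow S s is → (f : Frontier → ℕ) →
    ∑ (λ i → fromMaybe 0 (nth (map f S) i)) is ≡ ∑ f (successors k s)
  ∑-row S s {is} row f = begin
    ∑ (λ i → fromMaybe 0 (nth (map f S) i)) is
      ≡⟨ ∑-cong (λ i → cong (fromMaybe 0) (nth-map f S i)) is ⟩
    ∑ (λ i → fromMaybe 0 (Maybe.map f (nth S i))) is
      ≡⟨ cong sum (Listₚ.map-∘ is) ⟩
    ∑ (fromMaybe 0 ∘ Maybe.map f) (map (nth S) is)
      ≡⟨ cong (∑ (fromMaybe 0 ∘ Maybe.map f)) row ⟩
    ∑ (fromMaybe 0 ∘ Maybe.map f) (map just (successors k s))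
      ≡⟨ cong sum (Listₚ.map-∘ (successors k s)) ⟨
    ∑ f (successors k s) ∎
    where open ≡-Reasoning

  All-row : ∀ S s {is} {P : Frontier → Set} → ValidRow S s is → All P S → All P (successors k s)
  All-row S s {is} {P} row ps = All.map MaybeAll.drop-just (Allₚ.map⁻
    (subst (All (MaybeAll.All P)) row (Allₚ.map⁺ (All.universal (All-nth ps) is))))

  -- The matrix form of `completions-suc`.
  pull-completions : ∀ {S S′ T} n → Pointwise (ValidRow S′) S T →
    pull T (map (completions k n) S′) ≡ map (completions k (suc n)) S
  pull-completions                n []           = refl
  pull-completions {s ∷ _} {S′} n (row ∷ rows) = cong₂ _∷_
    (trans (∑-row S′ s row (completions k n)) (sym (completions-suc k n s)))
    (pull-completions n rows)

  pulls-completions : ∀ {S E} ch n → Valid S ch E →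
    pulls ch (map (completions k n) E) ≡ map (completions k (length ch + n)) S
  pulls-completions []             n refl           = refl
  pulls-completions ((T , _) ∷ ch) n (rows , valid) =
    trans (cong (pull T) (pulls-completions ch n valid)) (pull-completions (length ch + n) rows)

  -- `os` holds the number of full columns added to `n` for each coefficient in turn; these will be
  -- descending multiples of the period.
  Vanishes : List ℤ → List ℕ → ℕ → Frontier → Set
  Vanishes cs os n s = dot cs (map (λ o → + completions k (n + o) s) os) ≡ 0ℤ

  vanishes-step : ∀ {S S′ T} cs os n → Pointwise (ValidRow S′) S T →
    All (Vanishes cs os n) S′ → All (Vanishes cs os (suc n)) S
  vanishes-step                cs os n []           _  = []
  vanishes-step {s ∷ _} {S′} cs os n (row ∷ rows) vs =
    trans (cong (dot cs) (Listₚ.map-cong (λ o → cong +_ (completions-suc k (n + o) s)) os))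
          (dot-∑ cs (λ o → completions k (n + o)) os (All-row S′ s row vs))
    ∷ vanishes-step cs os n rows vs

  vanishes-chain : ∀ {S E} ch cs os n → Valid S ch E →
    All (Vanishes cs os n) E → All (Vanishes cs os (length ch + n)) S
  vanishes-chain []       cs os n refl           vs = vs
  vanishes-chain (_ ∷ ch) cs os n (rows , valid) vs =
    vanishes-step cs os (length ch + n) rows (vanishes-chain ch cs os n valid vs)

-- From a finite certificate to the recurrence

zipWith-map-map : ∀ {X Y Z W : Set} (h : Y → Z → W) (f : X → Y) (g : X → Z) xs →
  List.zipWith h (map f xs) (map g xs) ≡ map (λ x → h (f x) (g x)) xs
zipWith-map-map h f g []       = refl
zipWith-map-map h f g (x ∷ xs) = cong (h (f x) (g x) ∷_) (zipWith-map-map h f g xs)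

combination-map : ∀ cs (f : ℕ → Frontier → ℕ) os S →
  combination cs (map (λ o → map (f o) S) os) S ≡ map (λ s → dot cs (map (λ o → + f o s) os)) S
combination-map []       f os       S = refl
combination-map (c ∷ cs) f []       S = refl
combination-map (c ∷ cs) f (o ∷ os) S =
  trans (cong (List.zipWith (λ x y → c ℤ.* + x ℤ.+ y) (map (f o) S)) (combination-map cs f os S))
        (zipWith-map-map _ (f o) _ S)

-- `pre` brings each vector back to the single start frontier. The term of index 0 is supplied as
-- `x₀`, since the empty board has no frontier of two columns.
values : Chain → ℕ → List (List ℕ) → List ℤ
values pre x₀ vs = map (λ v → + fromMaybe 0 (List.head (pulls pre v))) vs ++ + x₀ ∷ []

-- The finite check: the homogeneous relation for the base vectors, the initial coefficients, where
-- `α` may be nonzero, and the listed first terms.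
Consistent : List ℤ → (ℕ → ℤ) → List ℕ → ℕ → Chain → List Frontier → List (List ℕ) → Set
Consistent cs α ys x₀ pre S vs =
  All (_≡ 0ℤ) (combination cs vs S) ×
  Satisfies cs α (values pre x₀ vs) ×
  take (length ys) (reverse (values pre x₀ vs)) ≡ map +_ ys

consistent? : ∀ cs α ys x₀ pre S vs → Dec (Consistent cs α ys x₀ pre S vs)
consistent? cs α ys x₀ pre S vs =
  All.all? (ℤₚ._≟ 0ℤ) (combination cs vs S) ×-dec
  satisfies? cs α (values pre x₀ vs) ×-dec
  Listₚ.≡-dec ℤₚ._≟_ (take (length ys) (reverse (values pre x₀ vs))) (map +_ ys)

take-applyUpTo : ∀ {X : Set} (f : ℕ → X) {m n} → m ℕ.≤ n → take m (applyUpTo f n) ≡ applyUpTo f m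
take-applyUpTo f z≤n       = refl
take-applyUpTo f (s≤s m≤n) = cong (f 0 ∷_) (take-applyUpTo (f ∘ suc) m≤n)

module Recurrence
  (k : ℕ) (s₀ : Frontier) (cs : List ℤ) (α : ℕ → ℤ) (ys : List ℕ) (x₀ : ℕ) where

  -- The relation is only required from the second element of the orbit on:
  -- combination drops the last entry of the list, which belongs to no full
  -- columns and violates the relation in the application below.
  record Certified (S : List Frontier) (pre cyc : Chain) : Set where
    constructor certified
    field
      validPre   : Valid k (s₀ ∷ []) pre S
      validCyc   : Valid k S cyc S
      consistent : Consistent cs α ys x₀ pre S (orbit cyc (map (completions k 0) S) (length cs))

  certified? : ∀ S pre cyc → Dec (Certified S pre cyc)
  certified? S pre cyc =
    map′ (λ (v , w , c) → certified v w c) (λ (certified v w c) → v , w , c)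
      (valid? k (s₀ ∷ []) pre S ×-dec valid? k S cyc S ×-dec
       consistent? cs α ys x₀ pre S (orbit cyc (map (completions k 0) S) (length cs)))

  module _ (x : ℕ → ℕ) (x0≡x₀ : x 0 ≡ x₀) {S pre cyc} (cert : Certified S pre cyc)
           (x≡ : ∀ m → completions k (length pre + length cyc ℕ.* m) s₀ ≡ x (suc m)) where

    open Certified cert using (validPre; validCyc)

    private
      L w : ℕ
      L = length cs
      w = length cyc

      xℤ : ℕ → ℤ
      xℤ n = + x n

      os : List ℕ
      -- One offset per vector of the orbit. `dot` reads only the first `L`, from `w * L` down to
      -- `w * 1`.
      os = applyDownFrom (w ℕ.*_) (suc L)

      vector : ℕ → List ℕ
      vector i = map (completions k (w ℕ.* i)) S

      orbit≡ : ∀ n → orbit cyc (map (completions k 0) S) n ≡ applyDownFrom vector (suc n)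
      orbit≡ zero    = cong (λ n → map (completions k n) S ∷ []) (sym (ℕₚ.*-zeroʳ w))
      orbit≡ (suc n) = trans (cong (prolong cyc) (orbit≡ n)) (cong (_∷ applyDownFrom vector (suc n)) (begin
        pulls cyc (vector n)                     ≡⟨ pulls-completions k cyc (w ℕ.* n) validCyc ⟩
        map (completions k (w + w ℕ.* n)) S      ≡⟨ cong (λ m → map (completions k m) S) (ℕₚ.*-suc w n) ⟨
        vector (suc n)                           ∎))
        where open ≡-Reasoning

      consistent′ : Consistent cs α ys (x 0) pre S (applyDownFrom vector (suc L))
      consistent′ = subst₂ (λ y vs → Consistent cs α ys y pre S vs) (sym x0≡x₀) (orbit≡ L)
        (Certified.consistent cert)

      values≡ : ∀ n → values pre (x 0) (applyDownFrom vector n) ≡ applyDownFrom xℤ (suc n)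
      values≡ zero    = refl
      values≡ (suc n) = cong₂ _∷_
        (trans (cong (λ v → + fromMaybe 0 (List.head v)) (pulls-completions k pre (w ℕ.* n) validPre))
               (cong +_ (x≡ n)))
        (values≡ n)

      vanishes-base : All (Vanishes k cs os 0) S
      vanishes-base = Allₚ.map⁻ (subst (All (_≡ 0ℤ))
        (trans (cong (λ vs → combination cs vs S)
                 (sym (Listₚ.map-applyDownFrom (w ℕ.*_) (λ o → map (completions k o) S) (suc L))))
               (combination-map cs (completions k) os S))
        (proj₁ consistent′))

      vanishes : ∀ m → All (Vanishes k cs os (w ℕ.* m)) S
      vanishes zero    = subst (λ n → All (Vanishes k cs os n) S) (sym (ℕₚ.*-zeroʳ w)) vanishes-base
      vanishes (suc m) = subst (λ n → All (Vanishes k cs os n) S) (sym (ℕₚ.*-suc w m))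
        (vanishes-chain k cyc cs os (w ℕ.* m) validCyc (vanishes m))

      x-shift : ∀ m i → completions k (length pre + w ℕ.* m + w ℕ.* i) s₀ ≡ x (i + suc m)
      x-shift m i = begin
        completions k (length pre + w ℕ.* m + w ℕ.* i) s₀
          ≡⟨ cong (λ n → completions k n s₀) (trans (ℕₚ.+-assoc (length pre) (w ℕ.* m) (w ℕ.* i))
               (cong (λ n → length pre + n)
                 (trans (ℕₚ.+-comm (w ℕ.* m) (w ℕ.* i)) (sym (ℕₚ.*-distribˡ-+ w i m))))) ⟩
        completions k (length pre + w ℕ.* (i + m)) s₀
          ≡⟨ x≡ (i + m) ⟩
        x (suc (i + m))
          ≡⟨ cong x (ℕₚ.+-suc i m) ⟨
        x (i + suc m) ∎
        where open ≡-Reasoning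

      -- At index `suc L + m` all terms that `dot` reads have positive index, hence are completions
      -- of `s₀`, and `pre` carries the relation from `S` back to `s₀`.
      beyond : ∀ m → dot cs (applyDownFrom xℤ (suc L + suc m)) ≡ 0ℤ
      beyond m = begin
        dot cs (applyDownFrom xℤ (suc L + suc m))
          ≡⟨ dot-applyDownFrom cs xℤ (suc m) (ℕₚ.n≤1+n L) ⟨
        dot cs (applyDownFrom (λ i → xℤ (i + suc m)) (suc L))
          ≡⟨ cong (dot cs) (Listₚ.map-downFrom (λ i → xℤ (i + suc m)) (suc L)) ⟨
        dot cs (map (λ i → xℤ (i + suc m)) (List.downFrom (suc L)))
          ≡⟨ cong (dot cs) (Listₚ.map-cong (λ i → cong +_ (sym (x-shift m i))) (List.downFrom (suc L))) ⟩
        dot cs (map (λ i → + completions k (length pre + w ℕ.* m + w ℕ.* i) s₀) (List.downFrom (suc L)))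
          ≡⟨ cong (dot cs) (trans (Listₚ.map-∘ (List.downFrom (suc L)))
               (cong (map _) (Listₚ.map-downFrom (w ℕ.*_) (suc L)))) ⟩
        dot cs (map (λ o → + completions k (length pre + w ℕ.* m + o) s₀) os)
          ≡⟨ All.head (vanishes-chain k pre cs os (w ℕ.* m) validPre (vanishes m)) ⟩
        0ℤ ∎
        where open ≡-Reasoning

    -- Indices up to `L` are settled by the finite check, larger ones by `beyond`, as `α` vanishes
    -- there.
    certified⇒convolution : (∀ m → α (L + m) ≡ 0ℤ) → ∀ n → dot cs (applyDownFrom xℤ (suc n)) ≡ α n
    certified⇒convolution α≡0 n with n ℕₚ.<? suc L
    ... | yes n< = satisfies-lookup cs α xℤ (ℕₚ.m<n⇒m<1+n n<)
                     (subst (Satisfies cs α) (values≡ (suc L)) (proj₁ (proj₂ consistent′)))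
    ... | no  n≮ = subst (λ n → dot cs (applyDownFrom xℤ (suc n)) ≡ α n)
                     (trans (ℕₚ.+-suc L _) (ℕₚ.m+[n∸m]≡n (ℕₚ.≮⇒≥ n≮)))
                     (trans (beyond (n ∸ suc L)) (sym (α≡0 (suc (n ∸ suc L)))))

    -- The check involves `2 + L` terms: `x 0` and one for each of the `suc L` vectors of the orbit.
    certified⇒first : length ys ℕ.≤ 2 + L → applyUpTo x (length ys) ≡ ys
    certified⇒first l≤ = Listₚ.map-injective ℤₚ.+-injective (begin
      map +_ (applyUpTo x (length ys))
        ≡⟨ Listₚ.map-applyUpTo x +_ (length ys) ⟩
      applyUpTo xℤ (length ys)
        ≡⟨ take-applyUpTo xℤ l≤ ⟨
      take (length ys) (applyUpTo xℤ (2 + L))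
        ≡⟨ cong (take (length ys)) (Listₚ.reverse-applyDownFrom xℤ (2 + L)) ⟨
      take (length ys) (reverse (applyDownFrom xℤ (2 + L)))
        ≡⟨ cong (take (length ys) ∘ reverse) (values≡ (suc L)) ⟨
      take (length ys) (reverse (values pre (x 0) (applyDownFrom vector (suc L))))
        ≡⟨ proj₂ (proj₂ consistent′) ⟩
      map +_ ys ∎)
      where open ≡-Reasoning

-- Power series

fromℤ-homo-+ : ∀ i j → fromℤ (i ℤ.+ j) ≡ fromℤ i ℚ.+ fromℤ j
fromℤ-homo-+ i j = ℚₚ.toℚᵘ-injective (ℚᵘₚ.≃-trans
  (ℚᵘ.*≡* (cong (ℤ._* + 1) (sym (cong₂ ℤ._+_ (ℤₚ.*-identityʳ i) (ℤₚ.*-identityʳ j)))))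
  (ℚᵘₚ.≃-sym (ℚₚ.toℚᵘ-homo-+ (fromℤ i) (fromℤ j))))

fromℤ-homo-* : ∀ i j → fromℤ (i ℤ.* j) ≡ fromℤ i ℚ.* fromℤ j
fromℤ-homo-* i j = ℚₚ.toℚᵘ-injective (ℚᵘₚ.≃-trans
  (ℚᵘ.*≡* refl)
  (ℚᵘₚ.≃-sym (ℚₚ.toℚᵘ-homo-* (fromℤ i) (fromℤ j))))

fromℤ-homo-neg : ∀ i → fromℤ (ℤ.- i) ≡ ℚ.- fromℤ i
fromℤ-homo-neg (+ zero)     = refl
fromℤ-homo-neg (+ suc _)    = refl
fromℤ-homo-neg (ℤ.-[1+ _ ]) = refl

coefficient-applyUpTo : ∀ (f : ℕ → ℤ) N → (∀ m → f (N + m) ≡ 0ℤ) → ∀ n →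
  coefficient (applyUpTo f N) n ≡ f n
coefficient-applyUpTo f zero    f≡0 n       = sym (f≡0 n)
coefficient-applyUpTo f (suc N) f≡0 zero    = refl
coefficient-applyUpTo f (suc N) f≡0 (suc n) = coefficient-applyUpTo (f ∘ suc) N f≡0 n

-- Reduces the product of series over the rationals to the integer `dot`. At a successor `n` the
-- `suc` in the index cancels, which gives the sum in the definition of `_*_`.
sum-coefficients : ∀ cs (x : ℕ → ℤ) n →
  ℚΣ.sum {n} (λ i → fromℤ (coefficient cs (toℕ i)) ℚ.* fromℤ (x (n ∸ suc (toℕ i)))) ≡
  fromℤ (dot cs (applyDownFrom x n))
sum-coefficients []       x zero    = refl
sum-coefficients (c ∷ cs) x zero    = refl
sum-coefficients []       x (suc n) =
  cong₂ ℚ._+_ (ℚₚ.*-zeroˡ (fromℤ (x n))) (sum-coefficients [] x n)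
sum-coefficients (c ∷ cs) x (suc n) = begin
  fromℤ c ℚ.* fromℤ (x n) ℚ.+ _
    ≡⟨ cong₂ ℚ._+_ (sym (fromℤ-homo-* c (x n))) (sum-coefficients cs x n) ⟩
  fromℤ (c ℤ.* x n) ℚ.+ fromℤ (dot cs (applyDownFrom x n))
    ≡⟨ fromℤ-homo-+ (c ℤ.* x n) (dot cs (applyDownFrom x n)) ⟨
  fromℤ (c ℤ.* x n ℤ.+ dot cs (applyDownFrom x n)) ∎
  where open ≡-Reasoning

*-cancelˡ-nonZero : ∀ p {q r} .{{_ : ℚ.NonZero p}} → p ℚ.* q ≡ p ℚ.* r → q ≡ r
*-cancelˡ-nonZero p {q} {r} pq≡pr = trans (sym (undo q)) (trans (cong (ℚ.1/ p ℚ.*_) pq≡pr) (undo r))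
  where
  undo : ∀ x → ℚ.1/ p ℚ.* (p ℚ.* x) ≡ x
  undo x = trans (sym (ℚₚ.*-assoc (ℚ.1/ p) p x))
    (trans (cong (ℚ._* x) (ℚₚ.*-inverseˡ p)) (ℚₚ.*-identityˡ x))

-- Strong induction: apart from `G 0` times the term at `n`, the coefficient at `n` involves only
-- smaller indices, so these parts agree and `G 0` can be cancelled.
*-cancelˡ-≈ : ∀ G {H K} .{{_ : ℚ.NonZero (G 0)}} → G * H ≈ G * K → H ≈ K
*-cancelˡ-≈ G {H} {K} GH≈GK = <-rec _ λ n rec → *-cancelˡ-nonZero (G 0)
  (ℚGroup.∙-cancelʳ (tail H n) _ _
    (trans (GH≈GK n) (cong (G 0 ℚ.* K n ℚ.+_) (sym (tail-cong n rec)))))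
  where
  tail : Series → ℕ → ℚ
  tail F n = ℚΣ.sum {n} λ i → G (suc (toℕ i)) ℚ.* F (n ∸ suc (toℕ i))
  tail-cong : ∀ n → (∀ {m} → m < n → H m ≡ K m) → tail H n ≡ tail K n
  tail-cong zero    rec = refl
  tail-cong (suc n) rec = ℚΣ.sum-cong-≗ {suc n} λ i →
    cong (G (suc (toℕ i)) ℚ.*_) (rec (s≤s (ℕₚ.m∸n≤m n (toℕ i))))

/-unique : ∀ F G {H} .{{_ : ℚ.NonZero (G 0)}} → G * H ≈ F → H ≈ F / G
/-unique F G GH≈F = *-cancelˡ-≈ G λ n → trans (GH≈F n) (sym (*-/-cancel F G n))

-- The 7 × 8n boards

-- The coefficients of `- A` and `B` as integers: they are embedded integers, which `↥` recovers by
-- computation.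
α β : ℕ → ℤ
α n = ℤ.- ↥ (A n)
β n = ↥ (B n)

βs : List ℤ
-- `B` has degree 26, hence 27 coefficients.
βs = applyUpTo β 27

firstTerms : List ℕ
firstTerms = 1 ∷ 14 ∷ 511 ∷ 18826 ∷ 699540 ∷ 26023308 ∷ 968374240 ∷ 36035363996 ∷ []

open Recurrence 7 (fullFrontier 7) βs α firstTerms 1

-- Every frontier that is reachable after 6 + 8 n columns for some n already
-- occurs after 14 columns.
recurrent : List Frontier
recurrent = reachable 7 14

-- The full frontier takes up two of the first eight columns; after six more steps the number of
-- full columns left is a multiple of 8.
approach period : List Frontier → Chain
approach S = chain 7 6 (fullFrontier 7 ∷ []) S
period S = chain 7 8 S S

length-chain : ∀ k n S E → length (chain k n S E) ≡ n
length-chain k zero          S E = refl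
length-chain k (suc zero)    S E = refl
length-chain k (suc (suc n)) S E = cong suc (length-chain k (suc n) _ E)

abstract
  certificate : Certified recurrent (approach recurrent) (period recurrent)
  -- The whole finite computation happens here: type checking evaluates the decision procedure to
  -- `yes`.
  certificate = toWitness {a? = certified?′ recurrent} _
    where
    -- A bound variable in place of recurrent is evaluated only once.
    certified?′ : ∀ S → Dec (Certified S (approach S) (period S))
    certified?′ S = certified? S (approach S) (period S)

completions≡a : ∀ m {r w} → r ≡ 6 → w ≡ 8 →
  completions 7 (r + w ℕ.* m) (fullFrontier 7) ≡ a (suc m)
completions≡a m refl refl =
  trans (completions-full 7 (6 + 8 ℕ.* m) (sym (ℕₚ.*-suc 8 m))) (sym (a≡numTilings (suc m)))
  where
  -- For a variable n, so that Agda does not evaluate the number of tilings.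
  a≡numTilings : ∀ n → a n ≡ numTilings 7 (8 ℕ.* n)
  a≡numTilings n = refl

completions-recurrent : ∀ m →
  completions 7 (length (approach recurrent) + length (period recurrent) ℕ.* m) (fullFrontier 7) ≡ a (suc m)
completions-recurrent m = completions≡a m
  (length-chain 7 6 (fullFrontier 7 ∷ []) recurrent) (length-chain 7 8 recurrent recurrent)

a0≡1 : a 0 ≡ 1
a0≡1 = refl

convolution : ∀ n → dot βs (applyDownFrom (λ n → + a n) (suc n)) ≡ α n
-- `A` has degree 25, so `α (27 + m)` computes to zero.
convolution = certified⇒convolution a a0≡1 certificate completions-recurrent λ _ → refl

B*generatingFunction≈-A : B * generatingFunction a ≈ - A
B*generatingFunction≈-A n = begin
  (B * generatingFunction a) n
    ≡⟨ ℚΣ.sum-cong-≗ {suc n} (λ i → cong (λ c → fromℤ c ℚ.* generatingFunction a (n ∸ toℕ i))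
         (sym (coefficient-applyUpTo β 27 (λ _ → refl) (toℕ i)))) ⟩
  ℚΣ.sum {suc n} (λ i → fromℤ (coefficient βs (toℕ i)) ℚ.* generatingFunction a (n ∸ toℕ i))
    ≡⟨ sum-coefficients βs (λ n → + a n) (suc n) ⟩
  fromℤ (dot βs (applyDownFrom (λ n → + a n) (suc n)))
    ≡⟨ cong fromℤ (convolution n) ⟩
  fromℤ (ℤ.- ↥ (A n))
    ≡⟨ fromℤ-homo-neg (↥ (A n)) ⟩
  (- A) n ∎
  where open ≡-Reasoning

proposition8 : (generatingFunction a ≈ (- A) / B)
    × (applyUpTo a 8 ≡ 1 ∷ 14 ∷ 511 ∷ 18826 ∷ 699540 ∷ 26023308 ∷ 968374240 ∷ 36035363996 ∷ [])
proposition8 =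
  /-unique (- A) B B*generatingFunction≈-A ,
  -- `8 + 21` equals `2 + 27`, the number of terms that the certificate covers.
  certified⇒first a a0≡1 certificate completions-recurrent (ℕₚ.m≤m+n 8 21)
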